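{- Let $U$ be a finite set, $\mathcal{O}\subseteq\mathcal{P}(U)$ an independent set of obligations, and $X\subseteq U$. Then: (1) If $X\prec_{l,s}U\setminus X$, then $X$ is $\preceq_s$-closed. (2) If $X$ is (ui), then $X$ is $\preceq_s$-closed. (3) If $X\in\mathcal{D}(\mathcal{O})$, then $X$ is $\preceq_s$-closed. (4) If $X$ is a neighbourhood, or an improving neighbourhood, of the set of best elements in $U$, then $X$ is $\preceq_s$-closed.
   Context: $U$ is a finite set, and $\mathcal{O}\subseteq\mathcal{P}(U)$ is a set of "obligations". For $\mathcal{O}'\subseteq\mathcal{O}$, $\delta:\mathcal{O}'\to\{0,1\}$ and $m\in U$, $m\models\delta$ iff for all $O\in\mathcal{O}'$: $m\in O\Leftrightarrow\delta(O)=1$. $\mathcal{O}$ is independent iff for every $\delta:\mathcal{O}\to\{0,1\}$ there is $m\in U$ with $m\models\delta$. For $x,y\in U$: - $\mathcal{O}(x):=\{O\in\mathcal{O}: x\in O\}$. - Quality (set variant; smaller means better): $x\preceq_s y$ iff $\mathcal{O}(y)\subseteq\mathcal{O}(x)$; $x\prec_s y$ iff $\mathcal{O}(y)\subsetneq\mathcal{O}(x)$. - Distance (set variant): $d_s(x,y):=\mathcal{O}(x)\,\triangle\,\mathcal{O}(y)$ (symmetric difference); distances are compared by inclusion. - $[x,z]_s:=\{y\in U: d_s(x,z)=d_s(x,y)\cup d_s(y,z)\}$. - A best element of $U$ is some $x\in U$ such that there is no $z\in U$ with $z\prec_s x$. - $X\subseteq U$ is $\preceq_s$-closed iff for all $x\in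 X$, $y\in U$: $y\preceq_s x$ implies $y\in X$. - An element $x'$ of a set $Y$ is closest to $x$ in $Y$ iff there is no $x''\in Y$ with $d_s(x,x'')\subsetneq d_s(x,x')$. Let $x\parallel Y$ be the set of elements of $Y$ closest to $x$. - $X\prec_{l,s}Y$ iff for all $x\in X$ and all $y\in x\parallel Y$ we have $x\prec_s y$, and for all $y\in Y$ and all $x\in y\parallel X$ we have $x\prec_s y$. - $X$ is (ui) (union of intersections) iff there is a family $(\mathcal{O}_i)_{i\in I}$ with $\mathcal{O}_i\subseteq\mathcal{O}$ and $X=\bigcup_{i\in I}\bigcap\mathcal{O}_i$, where $\bigcap\emptyset:=U$. - $X\in\mathcal{D}(\mathcal{O})$ iff for all $\mathcal{O}'\subseteq\mathcal{O}$, all $\delta:\mathcal{O}'\to\{0,1\}$ and all $m,m'\in U$ with $m,m'\models\delta$, $m\in X$, $m'\notin X$, there is $m''\in X$ with $m''\models\delta$ and $m''\prec_s m'$. - For $B\subseteq Y\subseteq U$: $Y$ is a neighbourhood of $B$ in $U$ iff for all $y\in Y$ and all $x\in B$ closest to $y$ in $B$, $[x,y]_s\subseteq Y$. $Y$ is an improving neighbourhood of $B$ in $U$ iff for all $y\in Y$ and all $x$ that are closest to $y$ in $\{x'\in B: x'\preceq_s y\}$, $[x,y]_s\subseteq Y$. (Both notions require $B\subseteq Y$.) -}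

module Defs where

open import Data.Bool using (Bool; true; T)
open import Data.Fin using (Fin)
open import Data.Fin.Subset using (Subset)
import Data.Fin.Subset as Subset
open import Data.Nat using (ℕ)
open import Data.Product using (_×_; ∃-syntax; Σ-syntax)
open import Function using (_∘_; _⇔_)
open import Level using (0ℓ)
open import Relation.Binary.PropositionalEquality using (_≡_)
open import Relation.Nullary using (¬_)
open import Relation.Unary using (Pred; _∈_; _∉_; _⊆_; _⊂_; _≐_; _∪_; _∖_; ⋃)

-- The finite set U is Fin n. Classically every set has decidable membership:
-- given sets of elements are therefore Subset n, and given sets of obligations
-- are Bool-valued. Sets derived from these are predicates.

⟦_⟧ : ∀ {n} → Subset n → Pred (Fin n) 0ℓ
⟦ X ⟧ m = m Subset.∈ X

Family : ℕ → Set
Family n = Subset n → Bool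

-- Membership T (𝒪 O) has at most one proof, so a valuation (below), although
-- it takes a membership proof, depends on the obligation alone.
⟪_⟫ : ∀ {n} → Family n → Pred (Subset n) 0ℓ
⟪ 𝒪 ⟫ O = T (𝒪 O)

Valuation : ∀ {n} → Family n → Set
Valuation 𝒪′ = ∀ O → O ∈ ⟪ 𝒪′ ⟫ → Bool

infix 4 _⊨_

_⊨_ : ∀ {n} {𝒪′ : Family n} → Fin n → Valuation 𝒪′ → Set
_⊨_ {𝒪′ = 𝒪′} m δ = ∀ O (O∈𝒪′ : O ∈ ⟪ 𝒪′ ⟫) → m ∈ ⟦ O ⟧ ⇔ δ O O∈𝒪′ ≡ true

Independent : ∀ {n} → Family n → Set
Independent {n} 𝒪 = ∀ (δ : Valuation 𝒪) → ∃[ m ] m ⊨ δ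

_⟨_⟩ : ∀ {n} → Family n → Fin n → Pred (Subset n) 0ℓ
(𝒪 ⟨ x ⟩) O = O ∈ ⟪ 𝒪 ⟫ × x ∈ ⟦ O ⟧

infix 4 _≼[_]_ _≺[_]_

_≼[_]_ : ∀ {n} → Fin n → Family n → Fin n → Set
x ≼[ 𝒪 ] y = 𝒪 ⟨ y ⟩ ⊆ 𝒪 ⟨ x ⟩

_≺[_]_ : ∀ {n} → Fin n → Family n → Fin n → Set
x ≺[ 𝒪 ] y = 𝒪 ⟨ y ⟩ ⊂ 𝒪 ⟨ x ⟩

dist : ∀ {n} → Family n → Fin n → Fin n → Pred (Subset n) 0ℓ
dist 𝒪 x y = (𝒪 ⟨ x ⟩ ∖ 𝒪 ⟨ y ⟩) ∪ (𝒪 ⟨ y ⟩ ∖ 𝒪 ⟨ x ⟩)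

interval : ∀ {n} → Family n → Fin n → Fin n → Pred (Fin n) 0ℓ
interval 𝒪 x z y = dist 𝒪 x z ≐ dist 𝒪 x y ∪ dist 𝒪 y z

Best : ∀ {n} → Family n → Pred (Fin n) 0ℓ
Best 𝒪 x = ¬ (∃[ z ] z ≺[ 𝒪 ] x)

Closed : ∀ {n} → Family n → Pred (Fin n) 0ℓ → Set
Closed 𝒪 X = ∀ x y → x ∈ X → y ≼[ 𝒪 ] x → y ∈ X

Closest : ∀ {n} → Family n → Fin n → Pred (Fin n) 0ℓ → Pred (Fin n) 0ℓ
Closest 𝒪 x Y x′ = x′ ∈ Y × ¬ (∃[ x″ ] (x″ ∈ Y × dist 𝒪 x x″ ⊂ dist 𝒪 x x′))

infix 4 _≺ₗ[_]_

_≺ₗ[_]_ : ∀ {n} → Pred (Fin n) 0ℓ → Family n → Pred (Fin n) 0ℓ → Set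
X ≺ₗ[ 𝒪 ] Y =
    (∀ x → x ∈ X → ∀ y → y ∈ Closest 𝒪 x Y → x ≺[ 𝒪 ] y)
  × (∀ y → y ∈ Y → ∀ x → x ∈ Closest 𝒪 y X → x ≺[ 𝒪 ] y)

-- The intersection of the empty family is the whole of Fin n.
⋂ : ∀ {n} → Family n → Pred (Fin n) 0ℓ
⋂ 𝒪′ m = ∀ O → O ∈ ⟪ 𝒪′ ⟫ → m ∈ ⟦ O ⟧

UI : ∀ {n} → Family n → Pred (Fin n) 0ℓ → Set₁
UI {n} 𝒪 X =
  Σ[ I ∈ Set ] Σ[ 𝒪ᵢ ∈ (I → Family n) ]
    (∀ i → ⟪ 𝒪ᵢ i ⟫ ⊆ ⟪ 𝒪 ⟫) × X ≐ ⋃ I (⋂ ∘ 𝒪ᵢ)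

𝒟 : ∀ {n} → Family n → Pred (Pred (Fin n) 0ℓ) 0ℓ
𝒟 {n} 𝒪 X =
  ∀ (𝒪′ : Family n) → ⟪ 𝒪′ ⟫ ⊆ ⟪ 𝒪 ⟫ → (δ : Valuation 𝒪′) →
  ∀ m m′ → m ⊨ δ → m′ ⊨ δ → m ∈ X → m′ ∉ X →
  ∃[ m″ ] (m″ ∈ X × m″ ⊨ δ × m″ ≺[ 𝒪 ] m′)

Neighbourhood : ∀ {n} → Family n → (B Y : Pred (Fin n) 0ℓ) → Set
Neighbourhood 𝒪 B Y =
  B ⊆ Y × (∀ y → y ∈ Y → ∀ x → x ∈ Closest 𝒪 y B → interval 𝒪 x y ⊆ Y)

ImprovingNeighbourhood : ∀ {n} → Family n → (B Y : Pred (Fin n) 0ℓ) → Set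
ImprovingNeighbourhood 𝒪 B Y =
  B ⊆ Y ×
  (∀ y → y ∈ Y → ∀ x → x ∈ Closest 𝒪 y (λ x′ → x′ ∈ B × x′ ≼[ 𝒪 ] y) →
    interval 𝒪 x y ⊆ Y)

{-# OPTIONS --safe #-}

-- Only (4) needs independence: it provides an element b satisfying every
-- obligation. Such a b is closest to every x among the best elements, and y ≼ x
-- places y in the interval [b, x].
-- For (1), given x ∈ X and y ≼ x with y ∉ X, take y′ ∉ X closest to x with
-- d(x, y′) ⊆ d(x, y). Then y′ ≼ x, whereas the hypothesis gives x ≺ y′.
-- For (3), let δ be the constant 0 on the obligations violated by y. An m″ ⊨ δ
-- satisfies no obligation that y violates, so m″ ≺ y is impossible.
module Submission where

open import Defs
open import Data.Bool using (true; false)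
open import Data.Bool.Properties using (T?)
open import Data.Fin using (Fin)
open import Data.Fin.Induction using (spo-wellFounded)
open import Data.Fin.Subset using (Subset)
open import Data.Fin.Subset.Properties using (_∈?_)
open import Data.Nat using (ℕ)
open import Data.Product using (_×_; _,_; proj₁; proj₂; ∃-syntax)
open import Data.Sum using (_⊎_; inj₁; inj₂; [_,_])
open import Function using (_∘_; mk⇔; Equivalence)
open import Induction.WellFounded using (WellFounded; Acc; acc)
open import Level using (0ℓ)
open import Relation.Binary.PropositionalEquality using (_≡_; refl; isEquivalence)
open import Relation.Nullary using (¬_; ⌊_⌋; yes; no; contradiction)
open import Relation.Nullary.Decidable using (decidable-stable; toWitness; fromWitness; ¬?; _×-dec_)
open import Relation.Unary using (Pred; _∈_; _∉_; _⊆_; _⊂_; ∁)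
open import Relation.Unary.Properties using (⊂-trans)

module _ {n : ℕ} (𝒪 : Family n) where

  -- A strict partial order on the finite set `Fin n` admits no infinite descent.
  closer-wellFounded : ∀ x → WellFounded (λ y z → dist 𝒪 x y ⊂ dist 𝒪 x z)
  closer-wellFounded x = spo-wellFounded {_≈_ = _≡_} record
    { isEquivalence = isEquivalence
    ; irrefl        = λ { refl (y⊆y , y⊉y) → y⊉y y⊆y }
    ; trans         = ⊂-trans
    ; <-resp-≈      = (λ { refl p → p }) , (λ { refl p → p })
    }

  -- Descend to strictly closer elements of `Y` until none is left. Neither `Y` nor strict inclusion
  -- of distances is assumed decidable, hence the double negation, which suffices for a stable goal.
  ¬¬closest : ∀ x (Y : Pred (Fin n) 0ℓ) {y} → y ∈ Y →
              ¬ ¬ (∃[ y′ ] (y′ ∈ Closest 𝒪 x Y × dist 𝒪 x y′ ⊆ dist 𝒪 x y))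
  ¬¬closest x Y {y} = go (closer-wellFounded x y)
    where
    go : ∀ {y} → Acc (λ y z → dist 𝒪 x y ⊂ dist 𝒪 x z) y → y ∈ Y →
         ¬ ¬ (∃[ y′ ] (y′ ∈ Closest 𝒪 x Y × dist 𝒪 x y′ ⊆ dist 𝒪 x y))
    go {y} (acc rec) y∈Y k = k (y , (y∈Y , y-minimal) , λ e → e)
      where
      y-minimal : ¬ (∃[ z ] (z ∈ Y × dist 𝒪 x z ⊂ dist 𝒪 x y))
      y-minimal (z , z∈Y , z<y) =
        go (rec z<y) z∈Y λ (y′ , cl , y′⊆z) → k (y′ , cl , λ e → proj₁ z<y (y′⊆z e))

  -- When `y ≼ x`, no obligation satisfied by `x` lies in d(x, y), hence none lies in the smaller
  -- d(x, y′).
  ≼-dist : ∀ {x y y′} → dist 𝒪 x y′ ⊆ dist 𝒪 x y → y ≼[ 𝒪 ] x → y′ ≼[ 𝒪 ] x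
  ≼-dist {y′ = y′} y′⊆y y≼x {O} (O∈𝒪 , x∈O) with y′ ∈? O
  ... | yes y′∈O = O∈𝒪 , y′∈O
  ... | no  y′∉O with y′⊆y (inj₁ ((O∈𝒪 , x∈O) , y′∉O ∘ proj₂))
  ...   | inj₁ (_ , ¬y) = contradiction (y≼x (O∈𝒪 , x∈O)) ¬y
  ...   | inj₂ (_ , ¬x) = contradiction (O∈𝒪 , x∈O) ¬x

  ≺ₗ⇒closed : (X : Subset n) → ⟦ X ⟧ ≺ₗ[ 𝒪 ] ∁ ⟦ X ⟧ → Closed 𝒪 ⟦ X ⟧
  ≺ₗ⇒closed X (X≺Y , _) x y x∈X y≼x = decidable-stable (y ∈? X) λ y∉X →
    ¬¬closest x (∁ ⟦ X ⟧) y∉X λ (y′ , cl , y′⊆y) →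
      proj₂ (X≺Y x x∈X y′ cl) (≼-dist {x} {y} {y′} y′⊆y y≼x)

  -- Passing from `x` to `y ≼ x` loses no obligation, so `y` stays in the very intersection that
  -- contains `x`.
  ui⇒closed : {X : Pred (Fin n) 0ℓ} → UI 𝒪 X → Closed 𝒪 X
  ui⇒closed (I , 𝒪ᵢ , 𝒪ᵢ⊆𝒪 , X⊆⋃ , ⋃⊆X) x y x∈X y≼x with X⊆⋃ x∈X
  ... | i , x∈⋂ = ⋃⊆X (i , λ O O∈𝒪ᵢ → proj₂ (y≼x (𝒪ᵢ⊆𝒪 i O∈𝒪ᵢ , x∈⋂ O O∈𝒪ᵢ)))

  𝒟⇒closed : (X : Subset n) → ⟦ X ⟧ ∈ 𝒟 𝒪 → Closed 𝒪 ⟦ X ⟧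
  𝒟⇒closed X X∈𝒟 x y x∈X y≼x = decidable-stable (y ∈? X) λ y∉X →
    let m″ , _ , m″⊨δ , m″≺y =
          X∈𝒟 violated violated⊆𝒪 δ x y
            -- What `y` violates, `x` violates too, because `y ≼ x`.
            (⊨δ (λ O∈𝒪 y∉O x∈O → y∉O (proj₂ (y≼x (O∈𝒪 , x∈O)))))
            (⊨δ (λ _ y∉O → y∉O)) x∈X y∉X
    in proj₂ m″≺y (m″⊨δ⇒y≼m″ m″⊨δ)
    where
    violated? = λ O → T? (𝒪 O) ×-dec ¬? (y ∈? O)

    violated : Family n
    violated O = ⌊ violated? O ⌋

    violated⊆𝒪 : ⟪ violated ⟫ ⊆ ⟪ 𝒪 ⟫
    violated⊆𝒪 {O} = proj₁ ∘ toWitness {a? = violated? O}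

    δ : Valuation violated
    δ _ _ = false

    ⊨δ : ∀ {m} → (∀ {O} → O ∈ ⟪ 𝒪 ⟫ → y ∉ ⟦ O ⟧ → m ∉ ⟦ O ⟧) → m ⊨ δ
    ⊨δ h O O∈ = let O∈𝒪 , y∉O = toWitness {a? = violated? O} O∈ in
      mk⇔ (λ m∈O → contradiction m∈O (h O∈𝒪 y∉O)) (λ ())

    m″⊨δ⇒y≼m″ : ∀ {m″} → m″ ⊨ δ → y ≼[ 𝒪 ] m″
    m″⊨δ⇒y≼m″ m″⊨δ {O} (O∈𝒪 , m″∈O) = O∈𝒪 , decidable-stable (y ∈? O) λ y∉O →
      contradiction
        (Equivalence.to (m″⊨δ O (fromWitness {a? = violated? O} (O∈𝒪 , y∉O))) m″∈O)
        (λ ())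

  Ideal : Pred (Fin n) 0ℓ
  Ideal b = b ∈ ⋂ 𝒪

  independent⇒ideal : Independent 𝒪 → ∃[ b ] b ∈ Ideal
  independent⇒ideal ind = let b , b⊨1 = ind (λ _ _ → true) in
    b , λ O O∈𝒪 → Equivalence.from (b⊨1 O O∈𝒪) refl

  module _ {b : Fin n} (ideal : b ∈ Ideal) where

    ideal-≼ : ∀ x → b ≼[ 𝒪 ] x
    ideal-≼ x (O∈𝒪 , _) = O∈𝒪 , ideal _ O∈𝒪

    ideal⇒best : b ∈ Best 𝒪
    ideal⇒best (z , z≺b) = proj₂ z≺b (ideal-≼ z)

    -- If `x` missed some obligation, `b` would be strictly better than `x`.
    best⇒ideal : Best 𝒪 ⊆ Ideal
    best⇒ideal {x} best O O∈𝒪 = decidable-stable (x ∈? O) λ x∉O →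
      best (b , ideal-≼ x , λ x≼b → x∉O (proj₂ (x≼b (O∈𝒪 , ideal O O∈𝒪))))

    -- All best elements satisfy the same obligations as `b`, so none is strictly closer to `x`. A
    -- general `Y` covers both all best elements and only those that are `≼ x`.
    ideal-closest : ∀ x {Y : Pred (Fin n) 0ℓ} → Y ⊆ Best 𝒪 → b ∈ Y → b ∈ Closest 𝒪 x Y
    ideal-closest x Y⊆best b∈Y = b∈Y , λ (x″ , x″∈Y , _ , ⊉) → ⊉ λ where
      (inj₁ (x∋O , ¬b)) → contradiction (ideal-≼ x x∋O) ¬b
      (inj₂ ((O∈𝒪 , _) , ¬x)) → inj₂ ((O∈𝒪 , best⇒ideal (Y⊆best x″∈Y) _ O∈𝒪) , ¬x)

    -- d(b, x) is the set of obligations violated by `x`. It splits into those `y` violates, which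
    -- form d(b, y), and those `y` satisfies, which form d(y, x).
    ≼⇒interval : ∀ {x y} → y ≼[ 𝒪 ] x → y ∈ interval 𝒪 b x
    ≼⇒interval {x} {y} y≼x = to , from
      where
      to : ∀ {O} → O ∈ dist 𝒪 b x → O ∈ dist 𝒪 b y ⊎ O ∈ dist 𝒪 y x
      to {O} (inj₁ (b∋O@(O∈𝒪 , _) , ¬x)) with y ∈? O
      ... | yes y∈O = inj₂ (inj₁ ((O∈𝒪 , y∈O) , ¬x))
      ... | no  y∉O = inj₁ (inj₁ (b∋O , y∉O ∘ proj₂))
      to (inj₂ (x∋O , ¬b)) = contradiction (ideal-≼ x x∋O) ¬b

      from : ∀ {O} → O ∈ dist 𝒪 b y ⊎ O ∈ dist 𝒪 y x → O ∈ dist 𝒪 b x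
      from (inj₁ (inj₁ (b∋O , ¬y))) = inj₁ (b∋O , λ x∋O → ¬y (y≼x x∋O))
      from (inj₁ (inj₂ (y∋O , ¬b))) = contradiction (ideal-≼ y y∋O) ¬b
      from (inj₂ (inj₁ (y∋O , ¬x))) = inj₁ (ideal-≼ y y∋O , ¬x)
      from (inj₂ (inj₂ (x∋O , ¬y))) = contradiction (y≼x x∋O) ¬y

    neighbourhood⇒closed : {X : Pred (Fin n) 0ℓ} →
      Neighbourhood 𝒪 (Best 𝒪) X → Closed 𝒪 X
    neighbourhood⇒closed (_ , intervals) x y x∈X y≼x =
      intervals x x∈X b (ideal-closest x (λ e → e) ideal⇒best) (≼⇒interval y≼x)

    improvingNeighbourhood⇒closed : {X : Pred (Fin n) 0ℓ} →
      ImprovingNeighbourhood 𝒪 (Best 𝒪) X → Closed 𝒪 X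
    improvingNeighbourhood⇒closed (_ , intervals) x y x∈X y≼x =
      intervals x x∈X b
        (ideal-closest x {λ x′ → x′ ∈ Best 𝒪 × x′ ≼[ 𝒪 ] x} proj₁ (ideal⇒best , ideal-≼ x))
        (≼⇒interval y≼x)

fact4p4 : ∀ (n : ℕ) (𝒪 : Family n) → Independent 𝒪 → (X : Subset n) →
    (⟦ X ⟧ ≺ₗ[ 𝒪 ] ∁ ⟦ X ⟧ → Closed 𝒪 ⟦ X ⟧)
    × (UI 𝒪 ⟦ X ⟧ → Closed 𝒪 ⟦ X ⟧)
    × (⟦ X ⟧ ∈ 𝒟 𝒪 → Closed 𝒪 ⟦ X ⟧)
    × (Neighbourhood 𝒪 (Best 𝒪) ⟦ X ⟧ ⊎ ImprovingNeighbourhood 𝒪 (Best 𝒪) ⟦ X ⟧ → Closed 𝒪 ⟦ X ⟧)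
fact4p4 n 𝒪 ind X with independent⇒ideal 𝒪 ind
... | b , ideal =
    ≺ₗ⇒closed 𝒪 X
  , ui⇒closed 𝒪
  , 𝒟⇒closed 𝒪 X
  , [ neighbourhood⇒closed 𝒪 ideal , improvingNeighbourhood⇒closed 𝒪 ideal ]
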